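{- For positive integers $n,d$, let \[ \mathrm{LCH}_{n,d}(\mathbf{x}) = \sum_{i_0=1}^{n} \left(\sum_{i_0 \le i_1 \le \cdots \le i_d \le n} x_{i_0,i_1}\, x_{i_1,i_2} \cdots x_{i_{d-1},i_d}\right) \in \mathbb{F}\langle x_{i,j} : 1\le i\le j\le n\rangle, \] and consider the bucketing system $(X_1,\dots,X_n)$ with $X_i=\{x_{i,j} : i\le j\le n\}$; $\mathrm{LCH}_{n,d}$ is abecedarian with respect to it. With respect to this bucketing system: (1) $\mathrm{LCH}_{n,d}$ can be computed by an abecedarian ABP of size $O(nd)$; (2) every abecedarian formula computing $\mathrm{LCH}_{n/2,\log n}$ has size $n^{\Omega(\log\log n)}$. In particular there is a super-polynomial separation between abecedarian ABPs and abecedarian formulas.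
   Context: All polynomials are non-commutative: the variables do not commute, so monomials are words over the variables. A bucketing system of size $m$ for a set of variables is an ordered tuple $(X_1,\dots,X_m)$ of sets forming a partition of that set. A polynomial $f$ is abecedarian with respect to $(X_1,\dots,X_m)$ if every monomial $y_1\cdots y_k$ ($k\ge 1$) with nonzero coefficient in $f$ satisfies $y_j\in X_{i_j}$ with $i_1\le i_2\le\cdots\le i_k$. For a polynomial $g$ and $1\le a\le b\le m+1$, the sub-polynomial $g[a,b)$ is the constant term of $g$ if $a=b$, and, if $a<b$, the sum of all terms $c\, y_1\cdots y_k$ ($k\ge1$) of $g$ with $y_j\in X_{i_j}$ and $a=i_1\le\cdots\le i_k<b$. We say $g$ is of type $[a,b)$ if $g=g[a,b)$. An ABP (algebraic branching program) is a directed acyclic graph with designated input and output vertices whose edges are labelled by affine forms in the variables; the polynomial computed between two vertices is the sum over all paths between them of the product of the edge labels taken in path order. An abecedarian ABP (with respect to $(X_1,\dots,X_m)$) is an ABP, possibly with several input and output vertices, in which every vertex is labelled by a bucket index so that whenever vertices $u,v$ carry labels $a,b$, the polynomial computed between $u$ and $v$ is of type $[a,b+1)$; the polynomial it computes is the sum of the polynomials computed between all (input, output) pairs. Size is the number of vertices. A (non-commutative) formula is a tree whose leaves are variables or field constants and whose internal gates are $+$ or $\times$, product gates multiplying their children in a fixed left-to-right order. An abecedarian formula (with respect to $(X_1,\dots,X_m)$) computing $f$ is a collection of formulas $\mathcal{F}_1,\dots,\mathcal{F}_m$ such that for each $i\in[m]$: $\mathcal{F}_i$ computes $f[i,m+1)$;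 each gate $v$ of $\mathcal{F}_i$ carries a label $I_v=[a,b)$ with $1\le a\le b\le m+1$, the root carrying $[i,m+1)$; the polynomial $f_v$ computed at $v$ satisfies $f_v=f_v[a,b)$; if $v$ is a sum gate, its children carry the same label as $v$; if $v=v_1\times v_2$ with $I_v=[a,a)$ then $I_{v_1}=I_{v_2}=[a,a)$; if $v=v_1\times v_2$ with $I_v=[a,b)$, $a<b$, then $(I_{v_1},I_{v_2})$ is $([a,b),[b,b))$, or $([a,a),[a,b))$, or $([a,c+1),[c,b))$ for some $a\le c<b$. The formula computes the sum of the polynomials computed by the $\mathcal{F}_i$, and its size is the total size of the $\mathcal{F}_i$. -}

module Defs where

open import Level using (Level; _⊔_) renaming (suc to lsuc)
open import Algebra.Bundles using (CommutativeRing)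
open import Relation.Nullary using (¬_)
open import Data.Product using (Σ; ∃; _×_; _,_)
open import Data.Bool using (Bool; true; false; _∧_; if_then_else_)
open import Data.Nat using (ℕ; zero; suc; _≡ᵇ_; _<ᵇ_; _≤ᵇ_; _≤_)
import Data.Nat as ℕ
open import Data.Fin using (Fin; toℕ)
import Data.Fin as Fin
open import Data.List using (List; []; _∷_; map; foldr; allFin; upTo; length)
open import Data.Nat.ListAction using () renaming (sum to sumℕ)
open import Relation.Binary.PropositionalEquality using (_≡_; _≢_)

record Field (c ℓ : Level) : Set (lsuc (c ⊔ ℓ)) where
  field
    commutativeRing : CommutativeRing c ℓ
  open CommutativeRing commutativeRing public
  field
    1≉0     : ¬ (1# ≈ 0#)
    inverse : ∀ x → ¬ (x ≈ 0#) → ∃ λ y → x * y ≈ 1#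

-- Variables x_{i,j}, 0 ≤ i ≤ j < m  (0-based; the paper's x_{i+1,j+1}).
-- The bucket of x_{i,j} is i, i.e. the bucketing system (X_1,…,X_m)
-- with X_i = {x_{i,j} : i ≤ j ≤ m}, buckets numbered 0,…,m-1 here.

record Var (m : ℕ) : Set where
  constructor var
  field
    row col : Fin m
    .row≤col : row Fin.≤ col

module _ {m : ℕ} where
  bucket : Var m → ℕ
  bucket x = toℕ (Var.row x)

  _≡ᵛ_ : Var m → Var m → Bool
  x ≡ᵛ y = (toℕ (Var.row x) ≡ᵇ toℕ (Var.row y)) ∧ (toℕ (Var.col x) ≡ᵇ toℕ (Var.col y))

-- Monomials of non-commuting variables are words.
Word : ℕ → Set
Word m = List (Var m)

module _ {m : ℕ} where
  chainBelow : ℕ → ℕ → Word m → Bool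
  chainBelow k b []      = true
  chainBelow k b (y ∷ w) = (k ≤ᵇ bucket y) ∧ (bucket y <ᵇ b) ∧ chainBelow (bucket y) b w

  -- inType a b w = true  iff  the monomial w may occur in a polynomial of
  -- type [a,b) (0-based bucket indices, so the paper's [a+1,b+1)):
  --   a = b : w is the empty word (constant term);
  --   a < b : w = y_1⋯y_k, k ≥ 1, buckets a = i_1 ≤ ⋯ ≤ i_k < b.
  -- (For a > b no monomial is allowed.)
  inType : ℕ → ℕ → Word m → Bool
  inType a b []      = a ≡ᵇ b
  inType a b (x ∷ w) = (bucket x ≡ᵇ a) ∧ (bucket x <ᵇ b) ∧ chainBelow (bucket x) b w

  chained : Word m → Bool
  chained []          = true
  chained (x ∷ [])    = true
  chained (x ∷ y ∷ w) = (toℕ (Var.col x) ≡ᵇ toℕ (Var.row y)) ∧ chained (y ∷ w)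

module Over {c ℓ : Level} (𝔽 : Field c ℓ) where
  open Field 𝔽

  sumC : List Carrier → Carrier
  sumC = foldr _+_ 0#

  -- Non-commutative polynomials in the variables Var m, given by their
  -- coefficient function on words.
  Poly : ℕ → Set c
  Poly m = Word m → Carrier

  module _ {m : ℕ} where
    infix 4 _≈P_
    _≈P_ : Poly m → Poly m → Set ℓ
    p ≈P q = ∀ w → p w ≈ q w

    0P : Poly m
    0P _ = 0#

    constP : Carrier → Poly m
    constP a []      = a
    constP a (_ ∷ _) = 0#

    1P : Poly m
    1P = constP 1#

    varP : Var m → Poly m
    varP x (y ∷ []) = if x ≡ᵛ y then 1# else 0#
    varP x _        = 0#

    _+P_ : Poly m → Poly m → Poly m
    (p +P q) w = p w + q w

    sumP : List (Poly m) → Poly m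
    sumP = foldr _+P_ 0P

    splits : Word m → List (Word m × Word m)
    splits []      = ([] , []) ∷ []
    splits (x ∷ w) = ([] , x ∷ w) ∷ map (λ { (u , v) → (x ∷ u , v) }) (splits w)

    _*P_ : Poly m → Poly m → Poly m
    (p *P q) w = sumC (map (λ { (u , v) → p u * q v }) (splits w))

    OfType : ℕ → ℕ → Poly m → Set ℓ
    OfType a b g = ∀ w → inType a b w ≡ false → g w ≈ 0#

    sub : ℕ → ℕ → Poly m → Poly m
    sub a b g w = if inType a b w then g w else 0#

  -- LCH_{m,d}: the sum over i_0 ≤ i_1 ≤ ⋯ ≤ i_d of x_{i0,i1}⋯x_{i_{d-1},i_d}.
  -- Since each such monomial is a word of length d of variables that chain,
  -- and distinct index sequences give distinct words (d ≥ 1), its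
  -- coefficient on a word w is 1 if w is a chain of length d, else 0.
  LCH : (m d : ℕ) → Poly m
  LCH m d w = if (length w ≡ᵇ d) ∧ chained w then 1# else 0#

  -- Abecedarian formulas.  LF m a b : formulas whose root gate carries the
  -- label [a,b) (0-based), with the structural label rules built in.

  data LF (m : ℕ) : ℕ → ℕ → Set c where
    leafVar   : ∀ {a b} → Var m → LF m a b
    leafConst : ∀ {a b} → Carrier → LF m a b
    plus      : ∀ {a b} → LF m a b → LF m a b → LF m a b
    timesC    : ∀ {a} → LF m a a → LF m a a → LF m a a
    timesR    : ∀ {a b} → a ℕ.< b → LF m a b → LF m b b → LF m a b
    timesL    : ∀ {a b} → a ℕ.< b → LF m a a → LF m a b → LF m a b
    timesM    : ∀ {a b} (k : ℕ) → a ≤ k → k ℕ.< b → LF m a (suc k) → LF m k b → LF m a b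

  module _ {m : ℕ} where
    eval : ∀ {a b} → LF m a b → Poly m
    eval (leafVar x)          = varP x
    eval (leafConst z)        = constP z
    eval (plus f g)           = eval f +P eval g
    eval (timesC f g)         = eval f *P eval g
    eval (timesR _ f g)       = eval f *P eval g
    eval (timesL _ f g)       = eval f *P eval g
    eval (timesM _ _ _ f g)   = eval f *P eval g

    size : ∀ {a b} → LF m a b → ℕ
    size (leafVar _)          = 1
    size (leafConst _)        = 1
    size (plus f g)           = suc (size f ℕ.+ size g)
    size (timesC f g)         = suc (size f ℕ.+ size g)
    size (timesR _ f g)       = suc (size f ℕ.+ size g)
    size (timesL _ f g)       = suc (size f ℕ.+ size g)
    size (timesM _ _ _ f g)   = suc (size f ℕ.+ size g)

    AllTyped : ∀ {a b} → LF m a b → Set ℓ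
    AllTyped {a} {b} f@(leafVar _)        = OfType a b (eval f)
    AllTyped {a} {b} f@(leafConst _)      = OfType a b (eval f)
    AllTyped {a} {b} f@(plus g h)         = OfType a b (eval f) × AllTyped g × AllTyped h
    AllTyped {a} {b} f@(timesC g h)       = OfType a b (eval f) × AllTyped g × AllTyped h
    AllTyped {a} {b} f@(timesR _ g h)     = OfType a b (eval f) × AllTyped g × AllTyped h
    AllTyped {a} {b} f@(timesL _ g h)     = OfType a b (eval f) × AllTyped g × AllTyped h
    AllTyped {a} {b} f@(timesM _ _ _ g h) = OfType a b (eval f) × AllTyped g × AllTyped h

  record AbecFormula (m : ℕ) (f : Poly m) : Set (c ⊔ ℓ) where
    field
      tree     : (i : Fin m) → LF m (toℕ i) m
      typed    : ∀ i → AllTyped (tree i)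
      computes : ∀ i → eval (tree i) ≈P sub (toℕ i) m f

    formulaSize : ℕ
    formulaSize = sumℕ (map (λ i → size (tree i)) (allFin m))

  -- ABPs.  Vertices are Fin s numbered in a topological order; there is an
  -- edge u → v (u < v) labelled by an affine form (label 0 = no edge).

  record Affine (m : ℕ) : Set c where
    field
      const : Carrier
      coef  : Var m → Carrier

  module _ {m : ℕ} where
    affP : Affine m → Poly m
    affP A []           = Affine.const A
    affP A (x ∷ [])     = Affine.coef A x
    affP A (_ ∷ _ ∷ _)  = 0#

  record ABP (m s : ℕ) : Set c where
    field
      edge   : Fin s → Fin s → Affine m
      input  : Fin s → Bool
      output : Fin s → Bool
      label  : Fin s → Fin m

    adj : Fin s → Fin s → Poly m
    adj u v = if toℕ u <ᵇ toℕ v then affP (edge u v) else 0P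

    pathsLen : ℕ → Fin s → Fin s → Poly m
    pathsLen zero    u v = if toℕ u ≡ᵇ toℕ v then 1P else 0P
    pathsLen (suc k) u v = sumP (map (λ w → adj u w *P pathsLen k w v) (allFin s))

    -- polynomial computed between u and v (paths have at most s edges)
    between : Fin s → Fin s → Poly m
    between u v = sumP (map (λ k → pathsLen k u v) (upTo (suc s)))

    computed : Poly m
    computed = sumP (map (λ u → sumP (map (λ v →
                 if input u ∧ output v then between u v else 0P) (allFin s))) (allFin s))

    IsAbecedarian : Set ℓ
    IsAbecedarian = ∀ u v → u ≢ v →
      OfType (toℕ (label u)) (suc (toℕ (label v))) (between u v)

{-# OPTIONS --safe #-}
module Submission where

open import Defs
open import Level using (Level)
open import Data.Bool using (Bool; true; false; _∧_; _∨_; if_then_else_)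
open import Data.Bool.Properties using (T-≡; ∧-zeroʳ; ∧-identityʳ)
open import Data.Empty using (⊥)
open import Data.Fin using (Fin; zero; suc; toℕ; fromℕ; fromℕ<; combine; quotient; remainder)
open import Data.Fin.Properties using (toℕ-fromℕ; toℕ-fromℕ<; toℕ<n; toℕ-injective; remQuot-combine; combine-remQuot; combine-monoˡ-<)
import Data.Fin.Properties as Fin
open import Data.List using (List; []; _∷_; _++_; length; map; allFin; upTo; applyUpTo; tabulate)
open import Data.List.Properties using (map-∘; map-tabulate; map-upTo; ++-identityʳ)
open import Data.Maybe using (Maybe; just; nothing; maybe′; _>>=_)
open import Data.Nat using (ℕ; zero; suc; pred; _+_; _*_; _^_; _≤_; _<_; z≤n; s≤s; _≡ᵇ_; _≤ᵇ_; _<ᵇ_; ⌊_/2⌋; ⌈_/2⌉; NonZero)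
open import Data.Nat.Induction using (<-rec)
open import Data.Nat.Logarithm using (⌊log₂_⌋; ⌊log₂⌋-mono-≤; ⌊log₂[2*b]⌋≡1+⌊log₂b⌋; ⌊log₂[2^n]⌋≡n; ⌊log₂⌊n/2⌋⌋≡⌊log₂n⌋∸1)
open import Data.Nat.Properties
open import Data.Nat.Solver using (module +-*-Solver)
open import Data.Product using (Σ; ∃; _×_; _,_; proj₁; proj₂)
open import Data.Sum using (_⊎_; inj₁; inj₂)
open import Function using (_∘_; id)
open import Function.Bundles using (Equivalence)
open import Relation.Binary.PropositionalEquality
open import Relation.Nullary using (Dec; yes; no; contradiction)
open import Relation.Nullary.Decidable using (dec-true; dec-false; recompute)

-- Lower bound: take chains 0 ≤ i₁ ≤ ⋯ ≤ i_r ≤ m - 1 whose inner indices range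
-- freely over r consecutive blocks of q values, so that all q^r of them occur
-- in LCH from index 0.  A product gate [a,k+1) × [k,b) can only cut a chain at
-- an inner index equal to k.  Following the longer factor from the root, a
-- chain of length r + 1 is cut at least ⌊log₂ (r + 1)⌋ times, and every cut
-- costs a factor q in the number of chains a single leaf accounts for; hence
-- size ≥ q^⌊log₂ (r + 1)⌋.  Upper bound: the vertices (t, i), with an edge
-- (t, i) → (t + 1, j) labelled x_{i,j}.

-- Booleans and decidable equality.

∨-false : ∀ a {b} → a ∨ b ≡ false → a ≡ false × b ≡ false
∨-false false h = refl , h

∧-falseˡ : ∀ {a b} → a ≡ false → a ∧ b ≡ false
∧-falseˡ refl = refl

∧-falseʳ : ∀ a {b} → b ≡ false → a ∧ b ≡ false
∧-falseʳ a refl = ∧-zeroʳ a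

∧-true : ∀ {a b} → a ≡ true → b ≡ true → a ∧ b ≡ true
∧-true refl b = b

indicator : Bool → ℕ
indicator b = if b then 1 else 0

indicator≤1 : ∀ b → indicator b ≤ 1
indicator≤1 true  = ≤-refl
indicator≤1 false = z≤n

≢⇒≡ᵇ-false : ∀ {m n} → m ≢ n → (m ≡ᵇ n) ≡ false
≢⇒≡ᵇ-false = dec-false (_ ≟ _)

≡ᵇ-refl : ∀ n → (n ≡ᵇ n) ≡ true
≡ᵇ-refl n = dec-true (n ≟ n) refl

≡ᵇ-true⇒≡ : ∀ {m n} → (m ≡ᵇ n) ≡ true → m ≡ n
≡ᵇ-true⇒≡ eq = ≡ᵇ⇒≡ _ _ (Equivalence.from T-≡ eq)

-- Binary logarithms and powers of two.

⌊log₂⌋-double : ∀ {n m} .{{_ : NonZero m}} → n ≤ 2 * m → ⌊log₂ n ⌋ ≤ suc ⌊log₂ m ⌋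
⌊log₂⌋-double {n} {m} n≤2m = ≤-trans (⌊log₂⌋-mono-≤ n≤2m) (≤-reflexive (⌊log₂[2*b]⌋≡1+⌊log₂b⌋ m))

2^⌊log₂n⌋≤n : ∀ n → 1 ≤ n → 2 ^ ⌊log₂ n ⌋ ≤ n
2^⌊log₂n⌋≤n = <-rec _ go
  where
  open ≤-Reasoning
  go : ∀ n → (∀ {m} → m < n → 1 ≤ m → 2 ^ ⌊log₂ m ⌋ ≤ m) → 1 ≤ n → 2 ^ ⌊log₂ n ⌋ ≤ n
  go n rec 1≤n with ⌊log₂ n ⌋ in eq
  ... | zero  = 1≤n
  go (suc zero)      rec 1≤n | suc L = contradiction eq λ ()
  go n@(suc (suc h)) rec 1≤n | suc L = begin
    2 * 2 ^ L                  ≡⟨ cong (λ z → 2 * 2 ^ z) (trans (⌊log₂⌊n/2⌋⌋≡⌊log₂n⌋∸1 n) (cong pred eq)) ⟨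
    2 * 2 ^ ⌊log₂ ⌊ n /2⌋ ⌋    ≤⟨ *-monoʳ-≤ 2 (rec (⌊n/2⌋<n (suc h)) (s≤s z≤n)) ⟩
    2 * ⌊ n /2⌋                ≡⟨ cong (⌊ n /2⌋ +_) (+-identityʳ _) ⟩
    ⌊ n /2⌋ + ⌊ n /2⌋          ≤⟨ +-monoʳ-≤ ⌊ n /2⌋ (⌊n/2⌋≤⌈n/2⌉ n) ⟩
    ⌊ n /2⌋ + ⌈ n /2⌉          ≡⟨ ⌊n/2⌋+⌈n/2⌉≡n n ⟩
    n                          ∎

n<2^suc⌊log₂n⌋ : ∀ n → n < 2 ^ suc ⌊log₂ n ⌋
n<2^suc⌊log₂n⌋ n with n <? 2 ^ suc ⌊log₂ n ⌋
... | yes n< = n<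
... | no  n≮ = contradiction
  (≤-trans (≤-reflexive (sym (⌊log₂[2^n]⌋≡n (suc ⌊log₂ n ⌋)))) (⌊log₂⌋-mono-≤ (≮⇒≥ n≮))) 1+n≰n

2^n≤m⇒n≤⌊log₂m⌋ : ∀ {n m} → 2 ^ n ≤ m → n ≤ ⌊log₂ m ⌋
2^n≤m⇒n≤⌊log₂m⌋ {n} h = ≤-trans (≤-reflexive (sym (⌊log₂[2^n]⌋≡n n))) (⌊log₂⌋-mono-≤ h)

-- With `r` = `7 + n` this bounds the number of blocks by a power of 2 with about half of `r` as
-- exponent. Adding 2 to `r` doubles the right side, hence one base case per parity.
7+n≤2^⌊7+n/2⌋ : ∀ n → 7 + n ≤ 2 ^ ⌊ 7 + n /2⌋
7+n≤2^⌊7+n/2⌋ 0 = n≤1+n 7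
7+n≤2^⌊7+n/2⌋ 1 = m≤m+n 8 8
7+n≤2^⌊7+n/2⌋ (suc (suc n)) = begin
  2 + (7 + n)         ≤⟨ +-monoˡ-≤ (7 + n) (m≤m+n 2 (5 + n)) ⟩
  (7 + n) + (7 + n)   ≡⟨ cong ((7 + n) +_) (+-identityʳ (7 + n)) ⟨
  2 * (7 + n)         ≤⟨ *-monoʳ-≤ 2 (7+n≤2^⌊7+n/2⌋ n) ⟩
  2 * 2 ^ ⌊ 7 + n /2⌋ ∎
  where open ≤-Reasoning

-- Finite sums of naturals.

Σ< : ℕ → (ℕ → ℕ) → ℕ
Σ< zero    f = 0
Σ< (suc n) f = f n + Σ< n f

Σ<-mono : ∀ n {f g} → (∀ j → j < n → f j ≤ g j) → Σ< n f ≤ Σ< n g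
Σ<-mono zero    h = z≤n
Σ<-mono (suc n) h = +-mono-≤ (h n ≤-refl) (Σ<-mono n λ j j<n → h j (m<n⇒m<1+n j<n))

Σ<-const : ∀ n {f c} → (∀ j → j < n → f j ≡ c) → Σ< n f ≡ n * c
Σ<-const zero    h = refl
Σ<-const (suc n) h = cong₂ _+_ (h n ≤-refl) (Σ<-const n λ j j<n → h j (m<n⇒m<1+n j<n))

Σ<-zero : ∀ n {f} → (∀ j → j < n → f j ≡ 0) → Σ< n f ≡ 0
Σ<-zero n h = trans (Σ<-const n h) (*-zeroʳ n)

Σ<-+ : ∀ n f g → Σ< n (λ j → f j + g j) ≡ Σ< n f + Σ< n g
Σ<-+ zero    f g = refl
Σ<-+ (suc n) f g rewrite Σ<-+ n f g =
  solve 4 (λ a b c d → (a :+ b) :+ (c :+ d) := (a :+ c) :+ (b :+ d)) refl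
    (f n) (g n) (Σ< n f) (Σ< n g)
  where open +-*-Solver

Σ<-*ʳ : ∀ n f c → Σ< n (λ j → f j * c) ≡ Σ< n f * c
Σ<-*ʳ zero    f c = refl
Σ<-*ʳ (suc n) f c = trans (cong (f n * c +_) (Σ<-*ʳ n f c)) (sym (*-distribʳ-+ c (f n) (Σ< n f)))

Σ<-indicator-above : ∀ n a k → a + n ≤ k → Σ< n (λ j → indicator (a + j ≡ᵇ k)) ≡ 0
Σ<-indicator-above zero    a k _ = refl
Σ<-indicator-above (suc n) a k h
  rewrite ≢⇒≡ᵇ-false (<⇒≢ (≤-trans (≤-reflexive (sym (+-suc a n))) h)) =
  Σ<-indicator-above n a k (≤-trans (+-monoʳ-≤ a (n≤1+n n)) h)

Σ<-indicator≤1 : ∀ n a k → Σ< n (λ j → indicator (a + j ≡ᵇ k)) ≤ 1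
Σ<-indicator≤1 zero    a k = z≤n
Σ<-indicator≤1 (suc n) a k with a + n ≡ᵇ k in eq
... | false = Σ<-indicator≤1 n a k
-- `Σ<` takes the top index first, so after a match at `a + n` all remaining values lie below `k`.
... | true  = ≤-reflexive (cong suc (Σ<-indicator-above n a k (≤-reflexive (≡ᵇ-true⇒≡ eq))))

-- Cutting index lists, and counting over blocks.

-- Decides whether js = l ++ k ∷ r for some l and r with A l and B r.
splitsAt : ℕ → (A B : List ℕ → Bool) → List ℕ → Bool
splitsAt k A B []       = false
splitsAt k A B (j ∷ js) = ((j ≡ᵇ k) ∧ (A [] ∧ B js)) ∨ splitsAt k (A ∘ (j ∷_)) B js

-- For soundness at product gates: once a gate rejects a chain, every actual cut at `k` leaves a
-- rejected factor. The recursion moves heads into `A`, which therefore sees the whole prefix.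
splitsAt-false : ∀ k A B l {r} → splitsAt k A B (l ++ k ∷ r) ≡ false → A l ≡ false ⊎ B r ≡ false
splitsAt-false k A B [] {r} h rewrite ≡ᵇ-refl k with A [] | B r
... | false | _     = inj₁ refl
... | true  | false = inj₂ refl
splitsAt-false k A B (j ∷ l) {r} h with (j ≡ᵇ k) ∧ (A [] ∧ B (l ++ k ∷ r))
... | false = splitsAt-false k (A ∘ (j ∷_)) B l h

module Blocks (q : ℕ) where

  -- The blocks are disjoint consecutive intervals of `q` values, so a list is increasing by
  -- construction while its entries can be chosen independently.
  data InBlocks : ℕ → ℕ → List ℕ → Set where
    []  : ∀ {p} → InBlocks p 0 []
    _∷_ : ∀ {p r j l} → j < q → InBlocks (suc p) r l → InBlocks p (suc r) (p * q + j ∷ l)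

  -- This counts the lists in `InBlocks p r` that satisfy `P`; as a nested sum it lets proofs
  -- recurse on the first entry.
  count : (List ℕ → Bool) → ℕ → ℕ → ℕ
  count P p zero    = indicator (P [])
  count P p (suc r) = Σ< q λ j → count (P ∘ (p * q + j ∷_)) (suc p) r

  count-mono : ∀ {P Q} p r → (∀ {l} → InBlocks p r l → P l ≡ true → Q l ≡ true) →
               count P p r ≤ count Q p r
  count-mono {P} {Q} p zero h with P [] | h []
  ... | false | _ = z≤n
  ... | true  | g rewrite g refl = ≤-refl
  count-mono p (suc r) h = Σ<-mono q λ j j<q → count-mono (suc p) r λ l∈ → h (j<q ∷ l∈)

  count-true : ∀ p r → count (λ _ → true) p r ≡ q ^ r
  count-true p zero    = refl
  count-true p (suc r) = Σ<-const q λ _ _ → count-true (suc p) r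

  count-false : ∀ p r → count (λ _ → false) p r ≡ 0
  count-false p zero    = refl
  count-false p (suc r) = Σ<-zero q λ _ _ → count-false (suc p) r

  count≤ : ∀ P p r → count P p r ≤ q ^ r
  count≤ P p r = ≤-trans (count-mono p r λ _ _ → refl) (≤-reflexive (count-true p r))

  count-∨ : ∀ P Q p r → count (λ l → P l ∨ Q l) p r ≤ count P p r + count Q p r
  count-∨ P Q p zero with P []
  ... | true  = m≤m+n 1 _
  ... | false = ≤-refl
  count-∨ P Q p (suc r) = ≤-trans
    (Σ<-mono q λ j _ → count-∨ (P ∘ (p * q + j ∷_)) (Q ∘ (p * q + j ∷_)) (suc p) r)
    (≤-reflexive (Σ<-+ q _ _))

  count-∧ : ∀ b Q p r → count (λ l → b ∧ Q l) p r ≡ indicator b * count Q p r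
  count-∧ true  Q p r = sym (*-identityˡ _)
  count-∧ false Q p r = count-false p r

  splitsAt-below : ∀ {k p r l} A B → k < p * q → InBlocks p r l → splitsAt k A B l ≡ false
  splitsAt-below A B k< [] = refl
  splitsAt-below {k} {p} A B k< (_∷_ {j = j} j<q l∈)
    rewrite ≢⇒≡ᵇ-false {p * q + j} {k} (>⇒≢ (<-≤-trans k< (m≤m+n (p * q) j))) =
    splitsAt-below (A ∘ (p * q + j ∷_)) B (<-≤-trans k< (m≤n+m (p * q) q)) l∈

  -- Blocks are disjoint, so at most one position of the list can hold k.
  count-splitsAt : ∀ k B p r →
    (∀ A → count (splitsAt k A B) p r ≡ 0) ⊎
    (∃ λ r₁ → ∃ λ r₂ → ∃ λ p′ → r ≡ r₁ + suc r₂ ×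
      (∀ A → count (splitsAt k A B) p r ≤ count A p r₁ * count B p′ r₂))
  count-splitsAt k B p zero = inj₁ λ _ → refl
  count-splitsAt k B p (suc r) with k <? suc p * q
  -- Here `k` lies in or below block `p`, so only the first entry can equal it: the left part is
  -- empty and the right part starts at block `suc p`.
  ... | yes k< = inj₂ (0 , r , suc p , refl , bound)
    where
    open ≤-Reasoning
    bound : ∀ A → count (splitsAt k A B) p (suc r) ≤ indicator (A []) * count B (suc p) r
    bound A = begin
      count (splitsAt k A B) p (suc r)
        ≤⟨ Σ<-mono q (λ j _ → begin
             count (λ l → here j l ∨ splitsAt k (A ∘ (p * q + j ∷_)) B l) (suc p) r
               ≤⟨ count-∨ (here j) _ (suc p) r ⟩
             count (here j) (suc p) r + count (splitsAt k (A ∘ (p * q + j ∷_)) B) (suc p) r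
               ≤⟨ +-monoʳ-≤ _ (count-mono {Q = λ _ → false} (suc p) r λ l∈ t →
                    trans (sym (splitsAt-below _ B k< l∈)) t) ⟩
             count (here j) (suc p) r + count (λ _ → false) (suc p) r
               ≡⟨ cong₂ _+_ (trans (count-∧ (p * q + j ≡ᵇ k) _ (suc p) r)
                              (cong (indicator (p * q + j ≡ᵇ k) *_) (count-∧ (A []) B (suc p) r)))
                            (count-false (suc p) r) ⟩
             indicator (p * q + j ≡ᵇ k) * X + 0
               ≡⟨ +-identityʳ _ ⟩
             indicator (p * q + j ≡ᵇ k) * X ∎) ⟩
      Σ< q (λ j → indicator (p * q + j ≡ᵇ k) * X)
        ≡⟨ Σ<-*ʳ q _ X ⟩
      Σ< q (λ j → indicator (p * q + j ≡ᵇ k)) * X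
        ≤⟨ *-monoˡ-≤ X (Σ<-indicator≤1 q (p * q) k) ⟩
      1 * X
        ≡⟨ *-identityˡ X ⟩
      X ∎
      where
      X = indicator (A []) * count B (suc p) r
      here : ℕ → List ℕ → Bool
      here j l = (p * q + j ≡ᵇ k) ∧ (A [] ∧ B l)
  -- Here `k` lies beyond block `p`, so the first entry joins the left part. The sizes found by the
  -- recursion serve every `A`, which matters because each `j` recurses with a different prefix.
  ... | no k≮ = later (count-splitsAt k B (suc p) r)
    where
    skip : ∀ A j → j < q → count (splitsAt k A B ∘ (p * q + j ∷_)) (suc p) r ≤
                           count (splitsAt k (A ∘ (p * q + j ∷_)) B) (suc p) r
    skip A j j<q = ≤-reflexive (cong (λ b → count (λ l → (b ∧ (A [] ∧ B l)) ∨ splitsAt k (A ∘ (p * q + j ∷_)) B l) (suc p) r)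
      (≢⇒≡ᵇ-false (<⇒≢ (<-≤-trans (+-monoʳ-< (p * q) j<q)
        (≤-trans (≤-reflexive (+-comm (p * q) q)) (≮⇒≥ k≮))))))
    later : _ → _
    later (inj₁ none) = inj₁ λ A → Σ<-zero q λ j j<q →
      n≤0⇒n≡0 (≤-trans (skip A j j<q) (≤-reflexive (none _)))
    later (inj₂ (r₁ , r₂ , p′ , eq , h)) = inj₂ (suc r₁ , r₂ , p′ , cong suc eq , λ A → ≤-trans
      (Σ<-mono q λ j j<q → ≤-trans (skip A j j<q) (h _))
      (≤-reflexive (Σ<-*ʳ q _ _)))

-- Words that spell chains.

-- Spells i js e w: the word w is x_{i,j₁} x_{j₁,j₂} ⋯ x_{j_r,e} for js = [j₁,…,j_r].
Spells : ∀ {m} → ℕ → List ℕ → ℕ → Word m → Set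
Spells i js       e []      = ⊥
Spells i []       e (x ∷ w) = toℕ (Var.row x) ≡ i × toℕ (Var.col x) ≡ e × w ≡ []
Spells i (j ∷ js) e (x ∷ w) = toℕ (Var.row x) ≡ i × toℕ (Var.col x) ≡ j × Spells j js e w

Spells-row : ∀ {m i e} js {x : Var m} {w} → Spells i js e (x ∷ w) → toℕ (Var.row x) ≡ i
Spells-row []      = proj₁
Spells-row (_ ∷ _) = proj₁

Spells-++ : ∀ {m i e} js (x : Var m) u y v → Spells i js e (x ∷ u ++ y ∷ v) →
  ∃ λ l → ∃ λ k → ∃ λ r → js ≡ l ++ k ∷ r × Spells i l k (x ∷ u) × Spells k r e (y ∷ v)
Spells-++ []       x []      y v (_ , _ , ())
Spells-++ []       x (_ ∷ _) y v (_ , _ , ())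
Spells-++ (j ∷ js) x []      y v (ri , cj , s) = [] , j , js , refl , (ri , cj , refl) , s
Spells-++ (j ∷ js) x (z ∷ u) y v (ri , cj , s) with Spells-++ js z u y v s
... | l , k , r , refl , sˡ , sʳ = j ∷ l , k , r , refl , (ri , cj , sˡ) , sʳ

row≤col : ∀ {m} (x : Var m) → toℕ (Var.row x) ≤ toℕ (Var.col x)
row≤col (var r c le) = recompute (toℕ r ≤? toℕ c) le

Spells-≤ : ∀ {m i e} js (w : Word m) → Spells i js e w → i ≤ e
Spells-≤ []       (x ∷ _) (refl , refl , _) = row≤col x
Spells-≤ (j ∷ js) (x ∷ w) (refl , refl , s) = ≤-trans (row≤col x) (Spells-≤ js w s)

Spells-chained : ∀ {m i e} js (w : Word m) → Spells i js e w → chained w ≡ true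
Spells-chained []       (x ∷ [])    s = refl
Spells-chained []       (x ∷ _ ∷ _) (_ , _ , ())
Spells-chained (j ∷ js) (x ∷ y ∷ w) (_ , cj , s) =
  ∧-true (dec-true (_ ≟ _) (trans cj (sym (Spells-row js s)))) (Spells-chained js (y ∷ w) s)

Spells-length : ∀ {m i e} js (w : Word m) → Spells i js e w → length w ≡ suc (length js)
Spells-length []       (x ∷ .[]) (_ , _ , refl) = refl
Spells-length (j ∷ js) (x ∷ w)   (_ , _ , s)    = cong suc (Spells-length js w s)

Spells-chainBelow : ∀ {m i e k b} js (w : Word m) → Spells i js e w → k ≤ i → e < b →
  chainBelow k b w ≡ true
Spells-chainBelow []       (x ∷ .[]) (refl , refl , refl) k≤i e<b =
  ∧-true (dec-true (_ ≤? _) k≤i) (∧-true (dec-true (_ <? _) (≤-<-trans (row≤col x) e<b)) refl)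
Spells-chainBelow (j ∷ js) (x ∷ w) (refl , refl , s) k≤i e<b =
  ∧-true (dec-true (_ ≤? _) k≤i) (∧-true
    (dec-true (_ <? _) (≤-<-trans (≤-trans (row≤col x) (Spells-≤ js w s)) e<b))
    (Spells-chainBelow js w s (row≤col x) e<b))

Spells-inType : ∀ {m i e b} js (w : Word m) → Spells i js e w → e < b → inType i b w ≡ true
Spells-inType js (x ∷ w) s e<b with Spells-row js s
... | refl = ∧-true (≡ᵇ-refl (toℕ (Var.row x)))
  -- On the whole word `chainBelow` first tests the bucket of `x` against itself; without that
  -- conjunct, exactly the remaining tests of `inType` are left.
  (∧-trueʳ (toℕ (Var.row x) ≤ᵇ toℕ (Var.row x)) (Spells-chainBelow js (x ∷ w) s ≤-refl e<b))
  where
  ∧-trueʳ : ∀ a {b} → a ∧ b ≡ true → b ≡ true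
  ∧-trueʳ true h = h

module _ (q : ℕ) where
  open Blocks q

  InBlocks-length : ∀ {p r l} → InBlocks p r l → length l ≡ r
  InBlocks-length []       = refl
  InBlocks-length (_ ∷ l∈) = cong suc (InBlocks-length l∈)

  -- Successive blocks make each index at least its predecessor, so the variables exist; the bound
  -- on `(p + r) * q` keeps all blocks within the range up to `m`, the common last index.
  InBlocks-spelled : ∀ {m p r l} i → InBlocks p r l → i ≤ p * q → i ≤ m → (p + r) * q ≤ suc m →
    Σ (Word (suc m)) (Spells i l m)
  InBlocks-spelled {m} i [] _ i≤m _ =
    var (fromℕ< (s≤s i≤m)) (fromℕ m)
      (subst₂ _≤_ (sym (toℕ-fromℕ< (s≤s i≤m))) (sym (toℕ-fromℕ m)) i≤m) ∷ [] ,
    toℕ-fromℕ< (s≤s i≤m) , toℕ-fromℕ m , refl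
  InBlocks-spelled {m} {p} i (_∷_ {r = r} {j = j} j<q l∈) i≤pq i≤m pr≤m
    with InBlocks-spelled (p * q + j) l∈ (<⇒≤ v<) (≤-pred v<m) (subst (λ z → z * q ≤ suc m) (+-suc p r) pr≤m)
    where
    v< : p * q + j < suc p * q
    v< = subst (p * q + j <_) (+-comm (p * q) q) (+-monoʳ-< (p * q) j<q)
    v<m : p * q + j < suc m
    v<m = <-≤-trans v< (≤-trans (*-monoˡ-≤ q (≤-trans (s≤s (m≤m+n p r)) (≤-reflexive (sym (+-suc p r))))) pr≤m)
  ... | w , s = var (fromℕ< (s≤s i≤m)) (fromℕ< v<m)
      (subst₂ _≤_ (sym (toℕ-fromℕ< (s≤s i≤m))) (sym (toℕ-fromℕ< v<m)) (≤-trans i≤pq (m≤m+n (p * q) j))) ∷ w ,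
    toℕ-fromℕ< (s≤s i≤m) , toℕ-fromℕ< v<m , s
    where
    v<m : p * q + j < suc m
    v<m = s≤s (Spells-≤ _ w s)

-- Runs of partial deterministic automata.

hits : ∀ {s} → Maybe (Fin s) → Fin s → Bool
hits nothing  v = false
hits (just u) v = toℕ u ≡ᵇ toℕ v

hits-true : ∀ {s} o {v : Fin s} → hits o v ≡ true → o ≡ just v
hits-true (just u) h = cong just (toℕ-injective (≡ᵇ-true⇒≡ h))

hits-≢ : ∀ {s} {u v : Fin s} → u ≢ v → hits (just u) v ≡ false
hits-≢ u≢v = ≢⇒≡ᵇ-false (u≢v ∘ toℕ-injective)

run : ∀ {m s} → (Fin s → Var m → Maybe (Fin s)) → Fin s → Word m → Maybe (Fin s)
run step u []      = just u
run step u (x ∷ w) = step u x >>= λ v → run step v w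

-- There are `d + 1` layers of `n` vertices, and `d + 1 ≤ 2 * d` yields the constant 2 of the upper
-- bound.
layered-size : ∀ n d → 1 ≤ d → suc d * n ≤ 2 * n * d
layered-size n d 1≤d = begin
  suc d * n     ≤⟨ *-monoˡ-≤ n (+-monoˡ-≤ d 1≤d) ⟩
  (d + d) * n   ≡⟨ cong (λ z → (d + z) * n) (+-identityʳ d) ⟨
  (2 * d) * n   ≡⟨ *-assoc 2 d n ⟩
  2 * (d * n)   ≡⟨ cong (2 *_) (*-comm d n) ⟩
  2 * (n * d)   ≡⟨ *-assoc 2 n d ⟨
  2 * n * d     ∎
  where open ≤-Reasoning

-- Coefficients of sums and products of polynomials.

module _ {c ℓ : Level} (𝔽 : Field c ℓ) where
  open Field 𝔽 using (Carrier; _≈_; 0#; 1#; 1≉0; zeroˡ; zeroʳ)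
    renaming (_+_ to _⊕_; _*_ to _⊗_; +-cong to ⊕-cong; *-cong to ⊗-cong; *-comm to ⊗-comm;
              +-identityˡ to ⊕-identityˡ; +-identityʳ to ⊕-identityʳ; *-identityˡ to ⊗-identityˡ;
              refl to ≈-refl; sym to ≈-sym; trans to ≈-trans; reflexive to ≈-reflexive)
  open Over 𝔽

  0⊕0 : ∀ {x y} → x ≈ 0# → y ≈ 0# → x ⊕ y ≈ 0#
  0⊕0 x≈0 y≈0 = ≈-trans (⊕-cong x≈0 y≈0) (⊕-identityˡ 0#)

  ⊗-zeroˡ : ∀ {x y} → x ≈ 0# → x ⊗ y ≈ 0#
  ⊗-zeroˡ x≈0 = ≈-trans (⊗-cong x≈0 ≈-refl) (zeroˡ _)

  ⊗-zeroʳ : ∀ {x y} → y ≈ 0# → x ⊗ y ≈ 0#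
  ⊗-zeroʳ y≈0 = ≈-trans (⊗-cong ≈-refl y≈0) (zeroʳ _)

  χ : Bool → Carrier
  χ b = if b then 1# else 0#

  sumC-cong : ∀ {a} {A : Set a} (xs : List A) {f g : A → Carrier} → (∀ a → f a ≈ g a) →
    sumC (map f xs) ≈ sumC (map g xs)
  sumC-cong []       h = ≈-refl
  sumC-cong (x ∷ xs) h = ⊕-cong (h x) (sumC-cong xs h)

  sumC-zero : ∀ {a} {A : Set a} (xs : List A) {f : A → Carrier} → (∀ a → f a ≈ 0#) → sumC (map f xs) ≈ 0#
  sumC-zero []       h = ≈-refl
  sumC-zero (x ∷ xs) h = 0⊕0 (h x) (sumC-zero xs h)

  sumP-at : ∀ {a m} {A : Set a} (f : A → Poly m) xs w → sumP (map f xs) w ≡ sumC (map (λ z → f z w) xs)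
  sumP-at f []       w = refl
  sumP-at f (x ∷ xs) w = cong (f x w ⊕_) (sumP-at f xs w)

  sumC-splits-zero : ∀ {m} (w : Word m) (g : Word m × Word m → Carrier) →
    (∀ u v → u ++ v ≡ w → g (u , v) ≈ 0#) → sumC (map g (splits w)) ≈ 0#
  sumC-splits-zero []      g h = 0⊕0 (h [] [] refl) ≈-refl
  sumC-splits-zero (x ∷ w) g h = 0⊕0 (h [] (x ∷ w) refl)
    (≈-trans (≈-reflexive (cong sumC (sym (map-∘ (splits w)))))
             (sumC-splits-zero w _ λ u v eq → h (x ∷ u) v (cong (x ∷_) eq)))

  -- The coefficient is a sum over the cuts of the word, so one vanishing factor per cut suffices.
  *P-zero : ∀ {m} (p q : Poly m) w → (∀ u v → u ++ v ≡ w → p u ≈ 0# ⊎ q v ≈ 0#) → (p *P q) w ≈ 0#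
  *P-zero p q w h = sumC-splits-zero w _ zero-term
    where
    zero-term : ∀ u v → u ++ v ≡ w → p u ⊗ q v ≈ 0#
    zero-term u v eq with h u v eq
    ... | inj₁ pu≈0 = ⊗-zeroˡ pu≈0
    ... | inj₂ qv≈0 = ⊗-zeroʳ qv≈0

  -- As `p` is a linear form without constant term, only the cut after the first letter survives.
  *P-linear : ∀ {m} (p q : Poly m) → p [] ≈ 0# → (∀ x y w → p (x ∷ y ∷ w) ≈ 0#) →
    ∀ x w → (p *P q) (x ∷ w) ≈ p (x ∷ []) ⊗ q w
  *P-linear p q p[]≈0 p≥2≈0 x []      = ≈-trans (⊕-cong (⊗-zeroˡ p[]≈0) (⊕-identityʳ _)) (⊕-identityˡ _)
  *P-linear p q p[]≈0 p≥2≈0 x (y ∷ w) = ≈-trans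
    (⊕-cong (⊗-zeroˡ p[]≈0) (≈-trans (⊕-cong ≈-refl long) (⊕-identityʳ _))) (⊕-identityˡ _)
    where
    long = ≈-trans
      (≈-reflexive (cong sumC (trans (sym (map-∘ (map _ (splits w)))) (sym (map-∘ (splits w))))))
      (sumC-splits-zero w _ λ u v _ → ⊗-zeroˡ (p≥2≈0 x y u))

  sumC-allFin-single : ∀ {s} (f : Fin s → Carrier) i → (∀ j → i ≢ j → f j ≈ 0#) →
    sumC (map f (allFin s)) ≈ f i
  sumC-allFin-single {s} f i h = ≈-trans (≈-reflexive (cong sumC (map-tabulate id f))) (single f i h)
    where
    zeros : ∀ {s} (f : Fin s → Carrier) → (∀ j → f j ≈ 0#) → sumC (tabulate f) ≈ 0#
    zeros {zero}  f h = ≈-refl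
    zeros {suc s} f h = 0⊕0 (h zero) (zeros (f ∘ suc) (h ∘ suc))
    single : ∀ {s} (f : Fin s → Carrier) i → (∀ j → i ≢ j → f j ≈ 0#) → sumC (tabulate f) ≈ f i
    single f zero    h = ≈-trans (⊕-cong ≈-refl (zeros (f ∘ suc) λ j → h (suc j) λ ())) (⊕-identityʳ (f zero))
    single f (suc i) h = ≈-trans (⊕-cong (h zero λ ()) (single (f ∘ suc) i λ j i≢j → h (suc j) (i≢j ∘ Fin.suc-injective)))
                                 (⊕-identityˡ (f (suc i)))

  sumC-upTo-single : ∀ (f : ℕ → Carrier) n i → i < n → (∀ j → i ≢ j → f j ≈ 0#) →
    sumC (map f (upTo n)) ≈ f i
  sumC-upTo-single f n i i<n h = ≈-trans (≈-reflexive (cong sumC (map-upTo f n))) (single f n i i<n h)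
    where
    zeros : ∀ f n → (∀ j → f j ≈ 0#) → sumC (applyUpTo f n) ≈ 0#
    zeros f zero    h = ≈-refl
    zeros f (suc n) h = 0⊕0 (h 0) (zeros (f ∘ suc) n (h ∘ suc))
    single : ∀ f n i → i < n → (∀ j → i ≢ j → f j ≈ 0#) → sumC (applyUpTo f n) ≈ f i
    single f (suc n) zero    _         h = ≈-trans (⊕-cong ≈-refl (zeros (f ∘ suc) n λ j → h (suc j) λ ())) (⊕-identityʳ (f 0))
    single f (suc n) (suc i) (s≤s i<n) h =
      ≈-trans (⊕-cong (h 0 λ ()) (single (f ∘ suc) n i i<n λ j i≢j → h (suc j) (i≢j ∘ suc-injective)))
              (⊕-identityˡ (f (suc i)))

  sumC-hits : ∀ {s} o (g : Fin s → Carrier) →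
    sumC (map (λ v → χ (hits o v) ⊗ g v) (allFin s)) ≈ maybe′ g 0# o
  sumC-hits {s} nothing  g = sumC-zero (allFin s) λ v → ⊗-zeroˡ ≈-refl
  sumC-hits {s} (just u) g = ≈-trans
    (sumC-allFin-single _ u λ v u≢v → ⊗-zeroˡ (≈-reflexive (cong χ (hits-≢ u≢v))))
    (≈-trans (⊗-cong (≈-reflexive (cong χ (≡ᵇ-refl (toℕ u)))) ≈-refl) (⊗-identityˡ (g u)))

  -- Upper bound: ABPs from automata, and the layered ABP.

  -- The ABP of a partial deterministic automaton: the words with coefficient 1
  -- between u and v are those that take the automaton from u to v.
  module Automaton {m s : ℕ} (step : Fin s → Var m → Maybe (Fin s))
    (increasing : ∀ {u x v} → step u x ≡ just v → toℕ u < toℕ v)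
    (start final : Fin s → Bool) (lab : Fin s → Fin m) where

    abp : ABP m s
    abp = record
      { edge   = λ u v → record { const = 0# ; coef = λ x → χ (hits (step u x) v) }
      ; input  = start
      ; output = final
      ; label  = lab
      }

    open ABP abp using (adj; pathsLen; between; computed)

    adj-[] : ∀ u v → adj u v [] ≈ 0#
    adj-[] u v with toℕ u <ᵇ toℕ v
    ... | true  = ≈-refl
    ... | false = ≈-refl

    adj-∷∷ : ∀ u v x y w → adj u v (x ∷ y ∷ w) ≈ 0#
    adj-∷∷ u v x y w with toℕ u <ᵇ toℕ v
    ... | true  = ≈-refl
    ... | false = ≈-refl

    -- The order test in `adj` discards no transition, because transitions increase the vertex
    -- number.
    adj-∷ : ∀ u v x → adj u v (x ∷ []) ≡ χ (hits (step u x) v)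
    adj-∷ u v x with toℕ u <? toℕ v
    ... | yes u<v rewrite dec-true (toℕ u <? toℕ v) u<v = refl
    ... | no  u≮v rewrite dec-false (toℕ u <? toℕ v) u≮v with hits (step u x) v in eq
    ...   | false = refl
    ...   | true  = contradiction (increasing (hits-true (step u x) eq)) u≮v

    -- Edge labels are linear forms without constant term, so paths with `k` edges contribute only
    -- words of length `k`, and determinism leaves at most one path per word.
    pathsLen-run : ∀ k u v w → pathsLen k u v w ≈ χ ((length w ≡ᵇ k) ∧ hits (run step u w) v)
    pathsLen-run zero u v [] with toℕ u ≡ᵇ toℕ v
    ... | true  = ≈-refl
    ... | false = ≈-refl
    pathsLen-run zero u v (x ∷ w) with toℕ u ≡ᵇ toℕ v
    ... | true  = ≈-refl
    ... | false = ≈-refl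
    pathsLen-run (suc k) u v [] = ≈-trans
      (≈-reflexive (sumP-at (λ z → adj u z *P pathsLen k z v) (allFin s) []))
      (sumC-zero (allFin s) λ z → 0⊕0 (⊗-zeroˡ (adj-[] u z)) ≈-refl)
    pathsLen-run (suc k) u v (x ∷ w) = ≈-trans
      (≈-reflexive (sumP-at (λ z → adj u z *P pathsLen k z v) (allFin s) (x ∷ w)))
      (≈-trans
        (sumC-cong (allFin s) λ z → ≈-trans
          (*P-linear (adj u z) (pathsLen k z v) (adj-[] u z) (adj-∷∷ u z) x w)
          (⊗-cong (≈-reflexive (adj-∷ u z x)) (pathsLen-run k z v w)))
        (≈-trans (sumC-hits (step u x) (λ z → χ ((length w ≡ᵇ k) ∧ hits (run step z w) v)))
          (≈-reflexive next)))
      where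
      next : maybe′ (λ z → χ ((length w ≡ᵇ k) ∧ hits (run step z w) v)) 0# (step u x) ≡
             χ ((length w ≡ᵇ k) ∧ hits (run step u (x ∷ w)) v)
      next with step u x
      ... | just z  = refl
      ... | nothing = cong χ (sym (∧-zeroʳ (length w ≡ᵇ k)))

    -- Every letter raises the vertex number. This keeps word lengths within the range of path
    -- lengths summed in `between`.
    run-length : ∀ u w {v} → run step u w ≡ just v → length w + toℕ u ≤ toℕ v
    run-length u []      refl = ≤-refl
    run-length u (x ∷ w) h with step u x in eq
    ... | just z = begin
      suc (length w + toℕ u)  ≡⟨ +-suc (length w) (toℕ u) ⟨
      length w + suc (toℕ u)  ≤⟨ +-monoʳ-≤ (length w) (increasing eq) ⟩
      length w + toℕ z        ≤⟨ run-length z w h ⟩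
      _                       ∎
      where open ≤-Reasoning

    between-run : ∀ u v w → between u v w ≈ χ (hits (run step u w) v)
    between-run u v w = ≈-trans (≈-reflexive (sumP-at (λ k → pathsLen k u v) (upTo (suc s)) w))
      (≈-trans (sumC-cong (upTo (suc s)) λ k → pathsLen-run k u v w) lengths)
      where
      lengths : sumC (map (λ k → χ ((length w ≡ᵇ k) ∧ hits (run step u w) v)) (upTo (suc s))) ≈
                χ (hits (run step u w) v)
      lengths with hits (run step u w) v in eq
      ... | false = sumC-zero (upTo (suc s)) λ k → ≈-reflexive (cong χ (∧-zeroʳ (length w ≡ᵇ k)))
      ... | true  = ≈-trans
        (sumC-upTo-single _ (suc s) (length w) (s≤s (≤-trans (m≤m+n _ _)
            (≤-trans (run-length u w (hits-true (run step u w) eq)) (<⇒≤ (toℕ<n v)))))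
          λ j w≢j → ≈-reflexive (cong (λ b → χ (b ∧ true)) (≢⇒≡ᵇ-false w≢j)))
        (≈-reflexive (cong (λ b → χ (b ∧ true)) (≡ᵇ-refl (length w))))

    accepted : Fin s → Word m → Bool
    accepted u w = maybe′ final false (run step u w)

    -- A run from a fixed start vertex has at most one end, so the sum over outputs collapses;
    -- different start vertices may still add up.
    computed-run : ∀ w → computed w ≈ sumC (map (λ u → χ (start u ∧ accepted u w)) (allFin s))
    computed-run w = ≈-trans (≈-reflexive (sumP-at _ (allFin s) w))
      (sumC-cong (allFin s) λ u → ≈-trans (≈-reflexive (sumP-at _ (allFin s) w))
        (≈-trans (sumC-cong (allFin s) (ends u))
          (≈-trans (sumC-hits (run step u w) (λ v → χ (start u ∧ final v))) (≈-reflexive (collect u)))))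
      where
      ends : ∀ u v → (if start u ∧ final v then between u v else 0P) w ≈
                     χ (hits (run step u w) v) ⊗ χ (start u ∧ final v)
      ends u v with start u ∧ final v
      ... | true  = ≈-trans (between-run u v w) (≈-sym (≈-trans (⊗-comm _ _) (⊗-identityˡ _)))
      ... | false = ≈-sym (⊗-zeroʳ ≈-refl)
      collect : ∀ u → maybe′ (λ v → χ (start u ∧ final v)) 0# (run step u w) ≡ χ (start u ∧ accepted u w)
      collect u with run step u w
      ... | just v  = refl
      ... | nothing = cong χ (sym (∧-zeroʳ (start u)))

  module Layered (n d : ℕ) where
    private
      s : ℕ
      s = suc d * n

    layer : Fin s → Fin (suc d)
    layer = quotient n

    index : Fin s → Fin n
    index = remainder {suc d} n

    layer-combine : ∀ t i → layer (combine t i) ≡ t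
    layer-combine t i = cong proj₁ (remQuot-combine t i)

    index-combine : ∀ t i → index (combine t i) ≡ i
    index-combine t i = cong proj₂ (remQuot-combine t i)

    step : Fin s → Var n → Maybe (Fin s)
    step u x with Var.row x Fin.≟ index u | toℕ (layer u) <? d
    ... | yes _ | yes t<d = just (combine (fromℕ< (s≤s t<d)) (Var.col x))
    ... | _     | _       = nothing

    step-just : ∀ {u x v} → step u x ≡ just v →
      Var.row x ≡ index u × Var.col x ≡ index v × toℕ (layer v) ≡ suc (toℕ (layer u))
    step-just {u} {x} h with Var.row x Fin.≟ index u | toℕ (layer u) <? d
    step-just {u} {x} refl | yes r | yes t<d =
      r , sym (index-combine t (Var.col x)) ,
      trans (cong toℕ (layer-combine t (Var.col x))) (toℕ-fromℕ< (s≤s t<d))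
      where t = fromℕ< (s≤s t<d)

    step-nothing : ∀ {u x} → step u x ≡ nothing → Var.row x ≡ index u → d ≤ toℕ (layer u)
    step-nothing {u} {x} h r with Var.row x Fin.≟ index u | toℕ (layer u) <? d
    ... | no r≢ | _      = contradiction r r≢
    ... | yes _ | no t≮d = ≮⇒≥ t≮d

    -- `combine` numbers vertices layer by layer, so a move to the next layer increases the number
    -- whatever the two indices are.
    increasing : ∀ {u x v} → step u x ≡ just v → toℕ u < toℕ v
    increasing {u} {x} {v} h with step-just {u} {x} {v} h
    ... | _ , _ , tv = subst₂ (λ a b → toℕ a < toℕ b) (combine-remQuot {suc d} n u) (combine-remQuot {suc d} n v)
      (combine-monoˡ-< (index u) (index v) (≤-reflexive (sym tv)))

    start final : Fin s → Bool
    start u = toℕ (layer u) ≡ᵇ 0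
    final u = toℕ (layer u) ≡ᵇ d

    open Automaton step (λ {u} {x} {v} → increasing {u} {x} {v}) start final index public

    run-Spells : ∀ u x w {v} → run step u (x ∷ w) ≡ just v →
      ∃ λ js → Spells (toℕ (index u)) js (toℕ (index v)) (x ∷ w)
    run-Spells u x w       h with step u x in eq
    run-Spells u x []      refl | just z with step-just {u} {x} eq
    ... | r , c , _ = [] , cong toℕ r , cong toℕ c , refl
    run-Spells u x (y ∷ w) h    | just z with step-just {u} {x} eq | run-Spells z y w h
    ... | r , c , _ | js , sp = _ ∷ js , cong toℕ r , cong toℕ c , sp

    -- A nonempty word read from `u` to `v` spells a chain between their indices and so has the
    -- required type. The empty word leads only from `u` to itself, which `u ≢ v` excludes.
    abecedarian : ABP.IsAbecedarian abp
    abecedarian u v u≢v w ¬type = ≈-trans (between-run u v w) (≈-reflexive (cong χ (unreachable w ¬type)))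
      where
      unreachable : ∀ w → inType (toℕ (index u)) (suc (toℕ (index v))) w ≡ false → hits (run step u w) v ≡ false
      unreachable []      _ = hits-≢ u≢v
      unreachable (x ∷ w) ¬type with hits (run step u (x ∷ w)) v in eq
      ... | false = refl
      ... | true with run-Spells u x w (hits-true (run step u (x ∷ w)) eq)
      ...   | js , sp = trans (sym (Spells-inType js (x ∷ w) sp ≤-refl)) ¬type

    accepted-row : ∀ u x w → Var.row x ≢ index u → accepted u (x ∷ w) ≡ false
    accepted-row u x w r≢ with Var.row x Fin.≟ index u
    ... | yes r = contradiction r r≢
    ... | no  _ = refl

    -- The row test in `step` compares each row with the preceding column, which is `chained`; the
    -- layers count letters, which is the length test.
    accepted-chained : ∀ u x w → Var.row x ≡ index u →
      accepted u (x ∷ w) ≡ (toℕ (layer u) + length (x ∷ w) ≡ᵇ d) ∧ chained (x ∷ w)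
    accepted-chained u x w r with step u x in eq
    -- With the right row the automaton is stuck only in the last layer, where one more letter also
    -- makes the length test fail.
    ... | nothing rewrite ≢⇒≡ᵇ-false (>⇒≢ (≤-<-trans (step-nothing eq r) (m<m+n (toℕ (layer u)) (s≤s (z≤n {length w}))))) = refl
    ... | just z with step-just {u} {x} eq
    ...   | _ , c , t = next w
      where
      next : ∀ w → accepted z w ≡ (toℕ (layer u) + suc (length w) ≡ᵇ d) ∧ chained (x ∷ w)
      next []      rewrite t | +-comm (toℕ (layer u)) 1 = sym (∧-identityʳ _)
      next (y ∷ w) = branch (Var.row y Fin.≟ index z)
        where
        branch : Dec (Var.row y ≡ index z) → accepted z (y ∷ w) ≡
          (toℕ (layer u) + suc (suc (length w)) ≡ᵇ d) ∧ (toℕ (Var.col x) ≡ᵇ toℕ (Var.row y)) ∧ chained (y ∷ w)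
        branch (yes r′) = trans (accepted-chained z y w r′) (cong₂ _∧_
          (cong (_≡ᵇ d) (trans (cong (_+ suc (length w)) t) (sym (+-suc (toℕ (layer u)) (suc (length w))))))
          (cong (_∧ chained (y ∷ w)) (sym (dec-true (_ ≟ _) (cong toℕ (trans c (sym r′)))))))
        branch (no r≢) = trans (accepted-row z y w r≢) (sym
          (∧-falseʳ (toℕ (layer u) + suc (suc (length w)) ≡ᵇ d)
            (∧-falseˡ {b = chained (y ∷ w)} (≢⇒≡ᵇ-false λ e → r≢ (trans (sym (toℕ-injective e)) c)))))

    computed-LCH : 1 ≤ d → ABP.computed abp ≈P LCH n d
    computed-LCH 1≤d [] = ≈-trans (computed-run []) (≈-trans
      (sumC-zero (allFin s) λ u → ≈-reflexive (cong χ (empty u)))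
      (≈-reflexive (sym (cong (λ b → χ (b ∧ true)) (≢⇒≡ᵇ-false (<⇒≢ 1≤d))))))
      where
      empty : ∀ u → start u ∧ final u ≡ false
      empty u with toℕ (layer u)
      ... | zero  = ≢⇒≡ᵇ-false (<⇒≢ 1≤d)
      ... | suc _ = refl
    computed-LCH 1≤d (x ∷ w) = ≈-trans (computed-run (x ∷ w)) (≈-trans
      (sumC-allFin-single _ u₀ λ u u₀≢u → ≈-reflexive (cong χ (elsewhere u u₀≢u)))
      (≈-reflexive (cong χ here)))
      where
      -- The only start vertex that can read the first letter, so each chain is counted once.
      u₀ : Fin s
      u₀ = combine {suc d} zero (Var.row x)
      here : start u₀ ∧ accepted u₀ (x ∷ w) ≡ (suc (length w) ≡ᵇ d) ∧ chained (x ∷ w)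
      here rewrite accepted-chained u₀ x w (sym (index-combine zero (Var.row x))) | layer-combine zero (Var.row x) = refl
      elsewhere : ∀ u → u₀ ≢ u → start u ∧ accepted u (x ∷ w) ≡ false
      elsewhere u u₀≢u with Var.row x Fin.≟ index u
      ... | no _  = ∧-zeroʳ (start u)
      ... | yes r = ∧-falseˡ (≢⇒≡ᵇ-false {toℕ (layer u)} {0} λ t → u₀≢u
        (trans (cong₂ combine (sym (toℕ-injective {i = layer u} {zero} t)) r) (combine-remQuot {suc d} n u)))

  -- Lower bound: chains accepted by a formula.

  -- A syntactic over-approximation of the support of F on chains.  A gate
  -- timesM k can only cut a chain at the index k, and the other products have
  -- a factor of type [b,b), i.e. a constant.
  accepts : ∀ {m a b} → LF m a b → ℕ → List ℕ → ℕ → Bool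
  accepts (leafVar x)        i []      e = (toℕ (Var.row x) ≡ᵇ i) ∧ (toℕ (Var.col x) ≡ᵇ e)
  accepts (leafVar x)        i (_ ∷ _) e = false
  accepts (leafConst _)      i js      e = false
  accepts (plus f g)         i js      e = accepts f i js e ∨ accepts g i js e
  accepts (timesC _ _)       i js      e = false
  accepts (timesR _ f _)     i js      e = accepts f i js e
  accepts (timesL _ _ g)     i js      e = accepts g i js e
  accepts (timesM k _ _ f g) i js      e = splitsAt k (λ l → accepts f i l k) (λ l → accepts g k l e) js

  typed-root : ∀ {m a b} (F : LF m a b) → AllTyped F → OfType a b (eval F)
  typed-root (leafVar _)        t = t
  typed-root (leafConst _)      t = t
  typed-root (plus _ _)         t = proj₁ t
  typed-root (timesC _ _)       t = proj₁ t
  typed-root (timesR _ _ _)     t = proj₁ t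
  typed-root (timesL _ _ _)     t = proj₁ t
  typed-root (timesM _ _ _ _ _) t = proj₁ t

  inType-[]-< : ∀ m {a b} → a < b → inType {m} a b [] ≡ false
  inType-[]-< m a<b = ≢⇒≡ᵇ-false (<⇒≢ a<b)

  inType-∷-row : ∀ {m a b} (x : Var m) w → toℕ (Var.row x) ≢ a → inType a b (x ∷ w) ≡ false
  inType-∷-row x w r≢a rewrite ≢⇒≡ᵇ-false r≢a = refl

  -- The first row would have to be both equal to `a` and below `a`. This makes factors labelled
  -- [a,a) constants.
  inType-∷-empty : ∀ {m a} (x : Var m) w → inType a a (x ∷ w) ≡ false
  inType-∷-empty {a = a} x w with toℕ (Var.row x) ≡ᵇ a in eq
  ... | false = refl
  ... | true rewrite ≡ᵇ-true⇒≡ {toℕ (Var.row x)} {a} eq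
                   | dec-false (a <? a) (<-irrefl refl) = refl

  -- Induction on the gates; at a product each cut of the word vanishes by the type of a factor or
  -- by the induction hypothesis.
  accepts-sound : ∀ {m a b} (F : LF m a b) → AllTyped F → ∀ i js e x w →
    Spells i js e (x ∷ w) → accepts F i js e ≡ false → eval F (x ∷ w) ≈ 0#
  accepts-sound (leafVar y) t i [] e x [] (refl , refl , refl) h rewrite h = ≈-refl
  accepts-sound (leafVar y) t i [] e x (_ ∷ _) (_ , _ , ()) h
  accepts-sound (leafVar y) t i (j ∷ js) e x [] (_ , _ , ()) h
  accepts-sound (leafVar y) t i (j ∷ js) e x (_ ∷ _) s h = ≈-refl
  accepts-sound (leafConst _) t i js e x w s h = ≈-refl
  accepts-sound (plus f g) (_ , tf , tg) i js e x w s h with ∨-false (accepts f i js e) h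
  ... | hf , hg = 0⊕0 (accepts-sound f tf i js e x w s hf) (accepts-sound g tg i js e x w s hg)
  accepts-sound (timesC _ _) t i js e x w s h = proj₁ t (x ∷ w) (inType-∷-empty x w)
  accepts-sound (timesR a<b f g) (_ , tf , tg) i js e x w s h = *P-zero (eval f) (eval g) (x ∷ w) λ where
    -- The right factor is a constant, so only the cut with an empty right part remains.
    u       (y ∷ v) eq   → inj₂ (typed-root g tg (y ∷ v) (inType-∷-empty y v))
    []      []      ()
    (_ ∷ _) []      refl → inj₁ (accepts-sound f tf i js e _ _ (subst (λ z → Spells i js e (x ∷ z)) (++-identityʳ _) s) h)
  accepts-sound (timesL a<b f g) (_ , tf , tg) i js e x w s h = *P-zero (eval f) (eval g) (x ∷ w) λ where
    (y ∷ u) v eq   → inj₁ (typed-root f tf (y ∷ u) (inType-∷-empty y u))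
    []      v refl → inj₂ (accepts-sound g tg i js e x w s h)
  accepts-sound {m} (timesM k a≤k k<b f g) (_ , tf , tg) i js e x w s h = *P-zero (eval f) (eval g) (x ∷ w) cut
    where
    cut : ∀ u v → u ++ v ≡ x ∷ w → eval f u ≈ 0# ⊎ eval g v ≈ 0#
    -- Both intervals [a,k+1) and [k,b) are nonempty, so neither factor has a constant term.
    cut []      v       eq   = inj₁ (typed-root f tf [] (inType-[]-< m (s≤s a≤k)))
    cut (_ ∷ _) []      eq   = inj₂ (typed-root g tg [] (inType-[]-< m k<b))
    cut (_ ∷ u) (y ∷ v) refl with Spells-++ js x u y v s
    ... | l , k′ , r , refl , sˡ , sʳ with k′ ≟ k
    -- A word of type [k,b) starts with row `k`, so the cut must be at the index `k` of the gate.
    ...   | no k′≢k = inj₂ (typed-root g tg (y ∷ v)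
                        (inType-∷-row y v λ eq → k′≢k (trans (sym (Spells-row r sʳ)) eq)))
    ...   | yes refl with splitsAt-false k _ _ l h
    ...     | inj₁ hˡ = inj₁ (accepts-sound f tf i l k x u sˡ hˡ)
    ...     | inj₂ hʳ = inj₂ (accepts-sound g tg k r e y v sʳ hʳ)

  -- Lower bound: counting accepted chains.

  module _ (q : ℕ) .{{_ : NonZero q}} where
    open Blocks q

    private
      L : ℕ → ℕ
      L r = ⌊log₂ suc r ⌋

      weaken : ∀ {P s t r} → P ≤ s * q ^ r → s ≤ t → P ≤ t * q ^ r
      weaken {r = r} h s≤t = ≤-trans h (*-monoˡ-≤ (q ^ r) s≤t)

      -- A chain with `r` inner indices has `r + 1` letters. The longer factor keeps at least half
      -- of them, so the logarithm drops by at most one.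
      L-split : ∀ r₁ r₂ → r₂ ≤ r₁ → L (r₁ + suc r₂) ≤ suc (L r₁)
      L-split r₁ r₂ r₂≤r₁ = ⌊log₂⌋-double {m = suc r₁} (begin
        suc r₁ + suc r₂      ≤⟨ +-monoʳ-≤ (suc r₁) (s≤s r₂≤r₁) ⟩
        suc r₁ + suc r₁      ≡⟨ cong (suc r₁ +_) (+-identityʳ (suc r₁)) ⟨
        2 * suc r₁           ∎)
        where open ≤-Reasoning

      -- The index at the cut is fixed, so `r₁ + r₂` of the `r₁ + suc r₂` indices stay free. The
      -- factor `q` lost there pays for the unit of logarithm lost in `L-split`.
      product-bound : ∀ {s} x y r₁ r₂ → r₂ ≤ r₁ → x * q ^ L r₁ ≤ s * q ^ r₁ → y ≤ q ^ r₂ →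
        (x * y) * q ^ L (r₁ + suc r₂) ≤ s * q ^ (r₁ + suc r₂)
      product-bound {s} x y r₁ r₂ r₂≤r₁ hx hy = begin
        (x * y) * q ^ L (r₁ + suc r₂)   ≤⟨ *-monoʳ-≤ (x * y) (^-monoʳ-≤ q (L-split r₁ r₂ r₂≤r₁)) ⟩
        (x * y) * (q * q ^ L r₁)        ≡⟨ solve 4 (λ x y q z → (x :* y) :* (q :* z) := (x :* z) :* (q :* y)) refl x y q (q ^ L r₁) ⟩
        (x * q ^ L r₁) * (q * y)        ≤⟨ *-mono-≤ hx (*-monoʳ-≤ q hy) ⟩
        (s * q ^ r₁) * (q * q ^ r₂)     ≡⟨ *-assoc s (q ^ r₁) _ ⟩
        s * (q ^ r₁ * q ^ suc r₂)       ≡⟨ cong (s *_) (^-distribˡ-+-* q r₁ (suc r₂)) ⟨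
        s * q ^ (r₁ + suc r₂)           ∎
        where
        open ≤-Reasoning
        open +-*-Solver using (solve; _:*_; _:=_)

    -- Multiplying the count by a power of `q` avoids subtraction in exponents. The ends `i`, `e`
    -- and the first block `p` are arbitrary because cuts produce pieces with other ends and blocks.
    count-accepts : ∀ {m a b} (F : LF m a b) i e p r →
      count (λ l → accepts F i l e) p r * q ^ ⌊log₂ suc r ⌋ ≤ size F * q ^ r
    -- A variable spells only a chain without inner indices; there the logarithm is 0 and both
    -- powers of `q` are 1.
    count-accepts F@(leafVar _) i e p zero = *-monoˡ-≤ 1 (indicator≤1 (accepts F i [] e))
    count-accepts (leafVar x) i e p (suc r)
      rewrite Σ<-zero q {λ j → count (λ _ → false) (suc p) r} (λ _ _ → count-false (suc p) r) = z≤n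
    count-accepts (leafConst _) i e p r rewrite count-false p r = z≤n
    count-accepts (timesC _ _) i e p r rewrite count-false p r = z≤n
    count-accepts (plus f g) i e p r = begin
      count (λ l → accepts f i l e ∨ accepts g i l e) p r * Q ≤⟨ *-monoˡ-≤ Q (count-∨ _ _ p r) ⟩
      (count _ p r + count _ p r) * Q                         ≡⟨ *-distribʳ-+ Q (count (λ l → accepts f i l e) p r) _ ⟩
      count _ p r * Q + count _ p r * Q                       ≤⟨ +-mono-≤ (count-accepts f i e p r) (count-accepts g i e p r) ⟩
      size f * q ^ r + size g * q ^ r                         ≡⟨ *-distribʳ-+ (q ^ r) (size f) (size g) ⟨
      (size f + size g) * q ^ r                               ≤⟨ *-monoˡ-≤ (q ^ r) (n≤1+n (size f + size g)) ⟩
      suc (size f + size g) * q ^ r                           ∎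
      where
      open ≤-Reasoning
      Q = q ^ ⌊log₂ suc r ⌋
    count-accepts (timesR _ f g) i e p r =
      weaken {r = r} (count-accepts f i e p r) (m≤n⇒m≤1+n (m≤m+n (size f) (size g)))
    count-accepts (timesL _ f g) i e p r =
      weaken {r = r} (count-accepts g i e p r) (m≤n⇒m≤1+n (m≤n+m (size g) (size f)))
    count-accepts (timesM k _ _ f g) i e p r with count-splitsAt k (λ l → accepts g k l e) p r
    ... | inj₁ none rewrite none (λ l → accepts f i l k) = z≤n
    ... | inj₂ (r₁ , r₂ , p′ , refl , cut) =
      ≤-trans (*-monoˡ-≤ (q ^ L (r₁ + suc r₂)) (cut (λ l → accepts f i l k))) longer-factor
      where
      X = count (λ l → accepts f i l k) p r₁
      Y = count (λ l → accepts g k l e) p′ r₂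
      longer-factor : (X * Y) * q ^ L (r₁ + suc r₂) ≤ suc (size f + size g) * q ^ (r₁ + suc r₂)
      -- Only the longer factor uses the induction hypothesis; the other gets the trivial bound
      -- `count≤`.
      longer-factor with ≤-total r₂ r₁
      ... | inj₁ r₂≤r₁ = weaken {r = r₁ + suc r₂}
        (product-bound {size f} X Y r₁ r₂ r₂≤r₁ (count-accepts f i k p r₁) (count≤ _ p′ r₂))
        (m≤n⇒m≤1+n (m≤m+n (size f) (size g)))
      ... | inj₂ r₁≤r₂ = weaken {r = r₁ + suc r₂}
        (subst₂ (λ z r → z * q ^ L r ≤ size g * q ^ r) (*-comm Y X) (trans (+-suc r₂ r₁) (trans (cong suc (+-comm r₂ r₁)) (sym (+-suc r₁ r₂))))
          (product-bound {size g} Y X r₂ r₁ r₁≤r₂ (count-accepts g k e p′ r₂) (count≤ _ p r₁)))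
        (m≤n⇒m≤1+n (m≤n+m (size g) (size f)))

  -- Lower bound: application to `LCH` and choice of parameters.

  LCH-Spells : ∀ {m i e} js (w : Word m) → Spells i js e w → LCH m (suc (length js)) w ≡ 1#
  LCH-Spells js w s rewrite Spells-length js w s | ≡ᵇ-refl (length js) | Spells-chained js w s = refl

  -- All `q ^ r` block chains from index 0 lie in the first bucket's part of `LCH`, so that one tree
  -- must accept them all; `count-accepts` then bounds its size.
  formulaSize≥ : ∀ m r q .{{_ : NonZero q}} → 1 ≤ m → r * q ≤ m →
    (F : AbecFormula m (LCH m (suc r))) → q ^ ⌊log₂ suc r ⌋ ≤ AbecFormula.formulaSize F
  formulaSize≥ (suc m) r q _ rq≤m F =
    ≤-trans (*-cancelʳ-≤ (q ^ ⌊log₂ suc r ⌋) (size T) (q ^ r) scaled) (m≤m+n (size T) _)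
    where
    open Blocks q
    open AbecFormula F
    instance
      _ = m^n≢0 q r
    T : LF (suc m) 0 (suc m)
    T = tree zero

    accepts-all : ∀ {l} → InBlocks 0 r l → accepts T 0 l m ≡ true
    accepts-all {l} l∈ with accepts T 0 l m in eq | InBlocks-spelled q 0 l∈ z≤n z≤n rq≤m
    ... | true  | _ = refl
    -- A rejected chain would have coefficient 0 in the tree but 1 in `LCH`.
    ... | false | x ∷ w , s = contradiction
      (≈-trans (≈-sym coefficient) (accepts-sound T (typed zero) 0 l m x w s eq)) 1≉0
      where
      coefficient : eval T (x ∷ w) ≈ 1#
      coefficient = ≈-trans (computes zero (x ∷ w)) (≈-reflexive (trans
        (cong (λ b → if b then LCH (suc m) (suc r) (x ∷ w) else 0#) (Spells-inType l (x ∷ w) s ≤-refl))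
        (subst (λ d → LCH (suc m) (suc d) (x ∷ w) ≡ 1#) (InBlocks-length q l∈) (LCH-Spells l (x ∷ w) s))))

    scaled : q ^ ⌊log₂ suc r ⌋ * q ^ r ≤ size T * q ^ r
    scaled = begin
      q ^ ⌊log₂ suc r ⌋ * q ^ r
        ≡⟨ *-comm _ (q ^ r) ⟩
      q ^ r * q ^ ⌊log₂ suc r ⌋
        ≡⟨ cong (_* q ^ ⌊log₂ suc r ⌋) (count-true 0 r) ⟨
      count (λ _ → true) 0 r * q ^ ⌊log₂ suc r ⌋
        ≤⟨ *-monoˡ-≤ (q ^ ⌊log₂ suc r ⌋) (count-mono 0 r λ l∈ _ → accepts-all l∈) ⟩
      count (λ l → accepts T 0 l m) 0 r * q ^ ⌊log₂ suc r ⌋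
        ≤⟨ count-accepts q T 0 m 0 r ⟩
      size T * q ^ r ∎
      where open ≤-Reasoning

  -- With q = 2^⌊d/2⌋ for d = ⌊log₂ n⌋, the d - 1 blocks fit below n/2 while
  -- n ≤ q⁴.
  formula-lower-bound : ∀ n → 2 ^ 8 ≤ n →
    (F : AbecFormula ⌊ n /2⌋ (LCH ⌊ n /2⌋ ⌊log₂ n ⌋)) →
    n ^ ⌊log₂ ⌊log₂ n ⌋ ⌋ ≤ AbecFormula.formulaSize F ^ 4
  formula-lower-bound n 2^8≤n F = main ⌊log₂ n ⌋ refl F
    where
    open ≤-Reasoning
    main : ∀ d → ⌊log₂ n ⌋ ≡ d → (F : AbecFormula ⌊ n /2⌋ (LCH ⌊ n /2⌋ d)) →
      n ^ ⌊log₂ d ⌋ ≤ AbecFormula.formulaSize F ^ 4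
    main d eq F with m≤n⇒∃[o]m+o≡n (≤-trans (2^n≤m⇒n≤⌊log₂m⌋ {8} 2^8≤n) (≤-reflexive eq))
    ... | o , refl = begin
      n ^ L                       ≤⟨ ^-monoˡ-≤ L n≤q^4 ⟩
      (q ^ 4) ^ L                 ≡⟨ ^-*-assoc q 4 L ⟩
      q ^ (4 * L)                 ≡⟨ cong (q ^_) (*-comm 4 L) ⟩
      q ^ (L * 4)                 ≡⟨ ^-*-assoc q L 4 ⟨
      (q ^ L) ^ 4                 ≤⟨ ^-monoˡ-≤ 4 (formulaSize≥ ⌊ n /2⌋ r q 1≤n/2 rq≤n/2 F) ⟩
      AbecFormula.formulaSize F ^ 4 ∎
      where
      r = 7 + o
      -- Here `suc r` is the degree `d`, at least 8 by the bound on `n`. As `h` is also `⌈ r /2⌉`,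
      -- `⌊ r /2⌋ + h` equals `r`.
      h = ⌊ suc r /2⌋
      q = 2 ^ h
      L = ⌊log₂ suc r ⌋
      instance
        _ = m^n≢0 2 h

      1≤n/2 : 1 ≤ ⌊ n /2⌋
      1≤n/2 = ⌊n/2⌋-mono (≤-trans (m≤m+n 2 254) 2^8≤n)

      rq≤n/2 : r * q ≤ ⌊ n /2⌋
      rq≤n/2 = begin
        r * q                     ≤⟨ *-monoˡ-≤ q (7+n≤2^⌊7+n/2⌋ o) ⟩
        2 ^ ⌊ r /2⌋ * 2 ^ h       ≡⟨ ^-distribˡ-+-* 2 ⌊ r /2⌋ h ⟨
        2 ^ (⌊ r /2⌋ + h)         ≡⟨ cong (2 ^_) (⌊n/2⌋+⌈n/2⌉≡n r) ⟩
        2 ^ r                     ≡⟨ cong (2 ^_) (trans (⌊log₂⌊n/2⌋⌋≡⌊log₂n⌋∸1 n) (cong pred eq)) ⟨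
        2 ^ ⌊log₂ ⌊ n /2⌋ ⌋       ≤⟨ 2^⌊log₂n⌋≤n ⌊ n /2⌋ 1≤n/2 ⟩
        ⌊ n /2⌋                   ∎

      n≤q^4 : n ≤ q ^ 4
      n≤q^4 = begin
        n                         ≤⟨ <⇒≤ (n<2^suc⌊log₂n⌋ n) ⟩
        2 ^ suc ⌊log₂ n ⌋         ≡⟨ cong (λ z → 2 ^ suc z) eq ⟩
        2 ^ (2 + r)               ≤⟨ ^-monoʳ-≤ 2 2+r≤4h ⟩
        2 ^ (h * 4)               ≡⟨ ^-*-assoc 2 h 4 ⟨
        q ^ 4                     ∎
        where
        2+r≤4h : 2 + r ≤ h * 4
        2+r≤4h = begin
          2 + r                   ≡⟨ cong (2 +_) (⌊n/2⌋+⌈n/2⌉≡n r) ⟨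
          2 + (⌊ r /2⌋ + h)       ≤⟨ +-mono-≤ {2} {h + h} (s≤s (s≤s z≤n)) (+-monoˡ-≤ h (⌊n/2⌋≤⌈n/2⌉ r)) ⟩
          (h + h) + (h + h)       ≡⟨ solve 1 (λ h → (h :+ h) :+ (h :+ h) := h :* con 4) refl h ⟩
          h * 4                   ∎
          where open +-*-Solver

theorem1p1 : ∀ {c ℓ : Level} (𝔽 : Field c ℓ) → let open Over 𝔽 in
    (Σ ℕ λ C → ∀ n d → 1 ≤ n → 1 ≤ d →
    Σ ℕ λ s → s ≤ C * n * d × Σ (ABP n s) λ A →
    ABP.IsAbecedarian A × ABP.computed A ≈P LCH n d)
    ×
    (Σ ℕ λ k → Σ ℕ λ N → ∀ n → N ≤ n →
    (F : AbecFormula ⌊ n /2⌋ (LCH ⌊ n /2⌋ ⌊log₂ n ⌋)) →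
    n ^ ⌊log₂ ⌊log₂ n ⌋ ⌋ ≤ AbecFormula.formulaSize F ^ suc k)
theorem1p1 𝔽 =
  (2 , λ n d _ 1≤d → let open Layered 𝔽 n d in
     suc d * n , layered-size n d 1≤d , abp , abecedarian , computed-LCH 1≤d) ,
  -- The power `suc 3` comes from `n≤q^4`: the size is at least `n` to a quarter of
  -- `⌊log₂ ⌊log₂ n ⌋ ⌋`.
  (3 , 2 ^ 8 , formula-lower-bound 𝔽)
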